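{- Let $r \in [0,1]$ be a real number. Then, for all integers $n \geq 2$, $r$ is the upper density of an $n$-c.e. set if and only if $r$ is the upper density of a co-c.e. set.
   Context: For $X \subseteq \omega=\{0,1,2,\dots\}$ and an integer $m>0$, let $\rho_m(X) = |\{j \in X : j < m\}|/m$. The upper density of $X$ is $\overline{\rho}(X)=\limsup_m \rho_m(X)$. Sets are identified with their characteristic functions. For a natural number $n$, a set $A \subseteq \omega$ is $n$-c.e. if there is a computable function $g:\omega\times\omega\to\{0,1\}$ such that for all $x$: $g(x,0)=0$, $A(x)=\lim_s g(x,s)$, and $|\{s : g(x,s) \neq g(x,s+1)\}| \leq n$. A set is co-c.e. if its complement in $\omega$ is c.e. -}

module Defs where

open import Level using (0ℓ)
open import Data.Bool.Base using (Bool; true; false; not; if_then_else_)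
open import Data.Fin.Base using (Fin)
open import Data.Integer.Base using (+_)
open import Data.List.Base using (length; filterᵇ; upTo)
open import Data.List.Membership.Propositional using (_∈_)
open import Data.Nat.Base as ℕ using (ℕ; suc; NonZero)
open import Data.Product using (∃; ∃-syntax; _×_; _,_)
open import Data.Rational.Base as ℚ using (ℚ; 0ℚ; 1ℚ)
import Data.Rational.Properties as ℚ
open import Data.Sum.Base using (_⊎_; inj₁; inj₂)
open import Data.Vec.Base using (Vec; []; _∷_; lookup)
open import Data.Vec.Relation.Binary.Pointwise.Inductive using (Pointwise)
open import Function.Base using (_∘_)
open import Function.Bundles using (_⇔_)
open import Relation.Binary.Definitions using (tri<; tri≈; tri>)
open import Relation.Binary.PropositionalEquality
  using (_≡_; _≢_; subst)
open import Relation.Nullary.Negation using (¬_)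
open import Relation.Unary using (Pred)

record ℝ : Set₁ where
  field
    L U       : Pred ℚ 0ℓ
    L-inhabited : ∃ L
    U-inhabited : ∃ U
    L-closed  : ∀ {p q} → p ℚ.< q → L q → L p
    U-closed  : ∀ {p q} → p ℚ.< q → U p → U q
    L-open    : ∀ {p} → L p → ∃[ q ] p ℚ.< q × L q
    U-open    : ∀ {q} → U q → ∃[ p ] p ℚ.< q × U p
    disjoint  : ∀ {q} → ¬ (L q × U q)
    located   : ∀ {p q} → p ℚ.< q → L p ⊎ U q

open ℝ public

infix 4 _≤ᴿ_

-- Two reals are regarded as equal when each is ≤ᴿ the other; every notion
-- below depends on a real only through ≤ᴿ.

_≤ᴿ_ : ℝ → ℝ → Set
x ≤ᴿ y = ∀ {q} → L x q → L y q

fromℚ : ℚ → ℝ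
fromℚ x = record
  { L           = ℚ._< x
  ; U           = x ℚ.<_
  ; L-inhabited = x ℚ.+ ℚ.- 1ℚ
                , subst (x ℚ.+ ℚ.- 1ℚ ℚ.<_) (ℚ.+-identityʳ x)
                    (ℚ.+-monoʳ-< x (ℚ.negative⁻¹ (ℚ.- 1ℚ)))
  ; U-inhabited = x ℚ.+ 1ℚ
                , subst (ℚ._< x ℚ.+ 1ℚ) (ℚ.+-identityʳ x)
                    (ℚ.+-monoʳ-< x (ℚ.positive⁻¹ 1ℚ))
  ; L-closed    = ℚ.<-trans
  ; U-closed    = λ p<q x<p → ℚ.<-trans x<p p<q
  ; L-open      = λ p<x → let (m , p<m , m<x) = ℚ.<-dense p<x in m , p<m , m<x
  ; U-open      = λ x<q → let (m , x<m , m<q) = ℚ.<-dense x<q in m , m<q , x<m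
  ; disjoint    = λ (q<x , x<q) → ℚ.<-asym q<x x<q
  ; located     = loc
  }
  where
  loc : ∀ {p q} → p ℚ.< q → p ℚ.< x ⊎ x ℚ.< q
  loc {p} p<q with ℚ.<-cmp p x
  ... | tri< p<x _ _ = inj₁ p<x
  ... | tri≈ _ p≡x _ = inj₂ (subst (ℚ._< _) p≡x p<q)
  ... | tri> _ _ x<p = inj₂ (ℚ.<-trans x<p p<q)

0ᴿ 1ᴿ : ℝ
0ᴿ = fromℚ 0ℚ
1ᴿ = fromℚ 1ℚ

IsInfimum : Pred ℝ 0ℓ → ℝ → Set₁
IsInfimum S r = (∀ u → S u → r ≤ᴿ u)
              × (∀ l → (∀ u → S u → l ≤ᴿ u) → l ≤ᴿ r)

EventualUpperBound : ((m : ℕ) .{{_ : NonZero m}} → ℝ) → Pred ℝ 0ℓ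
EventualUpperBound a u =
  ∃[ N ] (∀ m .{{_ : NonZero m}} → N ℕ.≤ m → a m ≤ᴿ u)

-- limsup a = inf_N sup_{m ≥ N} a m, written as the infimum of all upper
-- bounds of all tails so that the tail suprema need not be given as reals.

IsLimsup : ((m : ℕ) .{{_ : NonZero m}} → ℝ) → ℝ → Set₁
IsLimsup a = IsInfimum (EventualUpperBound a)

-- Subsets of ω are characteristic functions. An element of ℕ → Bool is an
-- arbitrary function: computability is always a separate hypothesis, stated
-- with IsComputable below.

SetOfℕ : Set
SetOfℕ = ℕ → Bool

∁ : SetOfℕ → SetOfℕ
∁ X = not ∘ X

count : SetOfℕ → ℕ → ℕ
count X m = length (filterᵇ X (upTo m))

ρ : SetOfℕ → (m : ℕ) .{{_ : NonZero m}} → ℚ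
ρ X m = + count X m ℚ./ m

IsUpperDensity : SetOfℕ → ℝ → Set₁
IsUpperDensity X = IsLimsup (λ m → fromℚ (ρ X m))

-- Kleene's partial recursive functions of k arguments.

data Code : ℕ → Set where
  zeroᶜ : Code 0
  sucᶜ  : Code 1
  projᶜ : ∀ {k} → Fin k → Code k
  compᶜ : ∀ {k l} → Code l → Vec (Code k) l → Code k
  recᶜ  : ∀ {k} → Code k → Code (suc (suc k)) → Code (suc k)
  minᶜ  : ∀ {k} → Code (suc k) → Code k

infix 4 _[_]↦_

-- c [ xs ]↦ y : the partial function coded by c is defined at xs with value y.

data _[_]↦_ : ∀ {k} → Code k → Vec ℕ k → ℕ → Set where
  zero↦ : zeroᶜ [ [] ]↦ 0
  suc↦  : ∀ {x} → sucᶜ [ x ∷ [] ]↦ suc x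
  proj↦ : ∀ {k} {i : Fin k} {xs} → projᶜ i [ xs ]↦ lookup xs i
  comp↦ : ∀ {k l} {f : Code l} {gs : Vec (Code k) l} {xs ys z} →
          Pointwise (λ g y → g [ xs ]↦ y) gs ys →
          f [ ys ]↦ z → compᶜ f gs [ xs ]↦ z
  rec₀↦ : ∀ {k} {f : Code k} {g xs y} →
          f [ xs ]↦ y → recᶜ f g [ 0 ∷ xs ]↦ y
  recₛ↦ : ∀ {k} {f : Code k} {g n xs y z} →
          recᶜ f g [ n ∷ xs ]↦ y → g [ n ∷ y ∷ xs ]↦ z →
          recᶜ f g [ suc n ∷ xs ]↦ z
  min↦  : ∀ {k} {f : Code (suc k)} {xs y} →
          (∀ z → z ℕ.< y → ∃[ v ] f [ z ∷ xs ]↦ suc v) →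
          f [ y ∷ xs ]↦ 0 → minᶜ f [ xs ]↦ y

IsComputable : ∀ {k} → (Vec ℕ k → ℕ) → Set
IsComputable f = ∃[ c ] (∀ xs → c [ xs ]↦ f xs)

IsComputable₁ : (ℕ → ℕ) → Set
IsComputable₁ f = IsComputable {1} λ { (x ∷ []) → f x }

bit : Bool → ℕ
bit b = if b then 1 else 0

IsComputable₂ᵇ : (ℕ → ℕ → Bool) → Set
IsComputable₂ᵇ g = IsComputable {2} λ { (x ∷ s ∷ []) → bit (g x s) }

-- c.e.: empty, or the range of a total computable function.

IsCE : SetOfℕ → Set
IsCE X = (∀ x → X x ≡ false)
       ⊎ (∃[ f ] IsComputable₁ f × (∀ x → X x ≡ true ⇔ (∃[ s ] f s ≡ x)))

IsCoCE : SetOfℕ → Set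
IsCoCE X = IsCE (∁ X)

-- |P| ≤ n: some list of length at most n contains all elements of P.

HasAtMost : ℕ → Pred ℕ 0ℓ → Set
HasAtMost n P = ∃[ l ] length l ℕ.≤ n × (∀ {s} → P s → s ∈ l)

record IsNCE (n : ℕ) (A : SetOfℕ) : Set where
  field
    g          : ℕ → ℕ → Bool
    computable : IsComputable₂ᵇ g
    initial    : ∀ x → g x 0 ≡ false
    limit      : ∀ x → ∃[ s₀ ] (∀ s → s₀ ℕ.≤ s → g x s ≡ A x)
    changes    : ∀ x → HasAtMost n (λ s → g x s ≢ g x (suc s))

{-# OPTIONS --safe #-}
module Submission where

open import Defs
open import Data.Nat.Base using (ℕ; _≤_)
open import Data.Product using (∃-syntax; _×_)
open import Function.Bundles using (_⇔_)

open import Data.Bool.Base using (Bool; true; false; T; not; if_then_else_; _∧_; _∨_)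
open import Data.Bool.Properties using (¬-not; not-injective; ∧-zeroʳ; T?)
open import Data.Empty using (⊥-elim)
open import Data.Fin.Base using (Fin)
open import Data.Fin.Patterns using (0F; 1F; 2F)
open import Data.Integer.Base as ℤ using (-[1+_])
import Data.Integer.Properties as ℤ
open import Data.List.Base using ([]; _∷_; _∷ʳ_; _++_; upTo; filterᵇ; length)
open import Data.List.Properties using (filter-++; length-++; upTo-∷ʳ)
open import Data.List.Relation.Unary.Any using (here; there)
open import Data.Nat.Base hiding (ℕ; _≤_)
open import Data.Nat.Coprimality using (Coprime)
open import Data.Nat.Properties
open import Data.Nat.Tactic.RingSolver using (solve-∀)
open import Data.Product using (_,_; proj₁; proj₂)
open import Data.Rational.Base as ℚ using (ℚ; mkℚ)
import Data.Rational.Properties as ℚ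
open import Data.Rational.Unnormalised.Base as ℚᵘ using (mkℚᵘ)
import Data.Rational.Unnormalised.Properties as ℚᵘ
open import Data.Sum.Base using (_⊎_; inj₁; inj₂; [_,_]′)
open import Data.Vec.Base using (Vec; []; _∷_; lookup)
open import Data.Vec.Relation.Binary.Pointwise.Inductive using ([]; _∷_)
open import Function.Base using (_∘_)
open import Function.Bundles using (mk⇔; module Equivalence)
open import Relation.Binary.Definitions using (tri<; tri≈; tri>)
open import Relation.Binary.PropositionalEquality
open import Relation.Nullary.Decidable
  using (Dec; yes; no; does; ¬?; _×-dec_; _⊎-dec_; decidable-stable; dec-true; dec-false)
open import Relation.Nullary.Negation using (¬_; contradiction)
open import Relation.Nullary.Reflects using (ofʸ; ofⁿ)

-- A co-c.e. set is 2-c.e.: put every x in at stage 1 and take it out once it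
-- is seen in the complement.
--
-- Conversely, only the existence of a computable approximation to A is used.
-- Cut ω into consecutive blocks so long that each dwarfs everything before it.
-- The n-th block carries a guess (k , s), decoded from n: that s is the stage
-- from which the approximation to |A ∩ [0, k + 1)| is constant. Every k has
-- exactly one correct s. Let B contain a final part of the block, making its
-- density at the end of the block about ρ A (k + 1), if the guess is correct,
-- and be empty on the block otherwise. A wrong guess is eventually refuted, so
-- B is co-c.e.; and the local maxima of the density of B follow, up to errors
-- tending to 0, the values ρ A (k + 1), each met finitely often and at least
-- once, so both sets have the same upper density.

-- Computable functions

private variable
  arity : ℕ

IsComputable₂ : (ℕ → ℕ → ℕ) → Set
IsComputable₂ f = IsComputable {2} λ { (x ∷ y ∷ []) → f x y }

computable-cong : {f g : Vec ℕ arity → ℕ} → (∀ xs → f xs ≡ g xs) →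
                  IsComputable f → IsComputable g
computable-cong f≗g (c , cf) = c , λ xs → subst (c [ xs ]↦_) (f≗g xs) (cf xs)

var : (i : Fin arity) → IsComputable (λ xs → lookup xs i)
var i = projᶜ i , λ _ → proj↦

ap₁ : {f : ℕ → ℕ} {a : Vec ℕ arity → ℕ} → IsComputable₁ f → IsComputable a →
      IsComputable (λ xs → f (a xs))
ap₁ (c , cf) (d , da) =
  compᶜ c (d ∷ []) , λ xs → comp↦ (da xs ∷ []) (cf (_ ∷ []))

ap₂ : {f : ℕ → ℕ → ℕ} {a b : Vec ℕ arity → ℕ} → IsComputable₂ f →
      IsComputable a → IsComputable b → IsComputable (λ xs → f (a xs) (b xs))
ap₂ (c , cf) (d , da) (e , eb) =
  compᶜ c (d ∷ e ∷ []) , λ xs → comp↦ (da xs ∷ eb xs ∷ []) (cf (_ ∷ _ ∷ []))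

sucᵖ : {a : Vec ℕ arity → ℕ} → IsComputable a → IsComputable (λ xs → suc (a xs))
sucᵖ = ap₁ (sucᶜ , λ { (_ ∷ []) → suc↦ })

lit : ∀ n → IsComputable {arity} (λ _ → n)
lit zero    = compᶜ zeroᶜ [] , λ _ → comp↦ [] zero↦
lit (suc n) = sucᵖ (lit n)

-- The recursion equations are hypotheses up to `_≡_`, so that `F` may be defined in any way, and
-- not only by the recursion that `recᶜ` performs.
rec-computable : {F : Vec ℕ (suc arity) → ℕ} {f : Vec ℕ arity → ℕ} {h : Vec ℕ (suc (suc arity)) → ℕ} →
                 (∀ xs → F (0 ∷ xs) ≡ f xs) →
                 (∀ n xs → F (suc n ∷ xs) ≡ h (n ∷ F (n ∷ xs) ∷ xs)) →
                 IsComputable f → IsComputable h → IsComputable F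
rec-computable {F = F} F0 Fs (c , cf) (d , dh) = recᶜ c d , λ { (n ∷ xs) → go n xs }
  where
  go : ∀ n xs → recᶜ c d [ n ∷ xs ]↦ F (n ∷ xs)
  go zero    xs rewrite F0 xs   = rec₀↦ (cf xs)
  go (suc n) xs rewrite Fs n xs = recₛ↦ (go n xs) (dh (n ∷ F (n ∷ xs) ∷ xs))

fun₁ : {f : ℕ → ℕ} {F : Vec ℕ 1 → ℕ} → IsComputable F →
       (∀ x → F (x ∷ []) ≡ f x) → IsComputable₁ f
fun₁ cF eq = computable-cong (λ { (x ∷ []) → eq x }) cF

fun₂ : {f : ℕ → ℕ → ℕ} {F : Vec ℕ 2 → ℕ} → IsComputable F →
       (∀ x y → F (x ∷ y ∷ []) ≡ f x y) → IsComputable₂ f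
fun₂ cF eq = computable-cong (λ { (x ∷ y ∷ []) → eq x y }) cF

ofBits : {g : ℕ → ℕ → Bool} → IsComputable₂ᵇ g → IsComputable₂ (λ x y → bit (g x y))
ofBits cg = fun₂ cg (λ _ _ → refl)

toBits : {g : ℕ → ℕ → Bool} {F : Vec ℕ 2 → ℕ} → IsComputable F →
         (∀ x y → F (x ∷ y ∷ []) ≡ bit (g x y)) → IsComputable₂ᵇ g
toBits cF eq = computable-cong (λ { (x ∷ y ∷ []) → eq x y }) cF

+-computable : IsComputable₂ _+_
+-computable = rec-computable (λ { (_ ∷ []) → refl }) (λ { _ (_ ∷ []) → refl })
                 (var 0F) (sucᵖ (var 1F))

*-computable : IsComputable₂ _*_
*-computable = rec-computable (λ { (_ ∷ []) → refl }) (λ { _ (_ ∷ []) → refl })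
                 (lit 0) (ap₂ +-computable (var 2F) (var 1F))

pred-computable : IsComputable₁ pred
pred-computable = rec-computable (λ { [] → refl }) (λ { _ [] → refl }) (lit 0) (var 0F)

∸-computable : IsComputable₂ _∸_
-- `recᶜ` recurses on the first argument, whereas iterating `pred` recurses on the number
-- subtracted.
∸-computable = fun₂ (ap₂ flipped (var 1F) (var 0F)) (λ _ _ → refl)
  where
  flipped : IsComputable₂ (λ n m → m ∸ n)
  flipped = rec-computable (λ { (_ ∷ []) → refl })
              (λ { n (m ∷ []) → sym (pred[m∸n]≡m∸[1+n] m n) })
              (var 0F) (ap₁ pred-computable (var 1F))

-- Both branches are evaluated before `select` picks one, which is harmless since all functions here
-- are total.
if-computable : {b : Vec ℕ arity → Bool} {t e : Vec ℕ arity → ℕ} →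
                IsComputable (λ xs → bit (b xs)) → IsComputable t → IsComputable e →
                IsComputable (λ xs → if b xs then t xs else e xs)
if-computable {arity} {b} {t} {e} (cb , pb) (ct , pt) (ce , pe) =
  compᶜ (proj₁ branch) (cb ∷ ct ∷ ce ∷ []) ,
  λ xs → subst (_ [ xs ]↦_) (branch-bit (b xs))
           (comp↦ (pb xs ∷ pt xs ∷ pe xs ∷ []) (proj₂ branch (_ ∷ _ ∷ _ ∷ [])))
  where
  select : ℕ → ℕ → ℕ → ℕ
  select zero    x y = y
  select (suc _) x y = x

  branch : IsComputable {3} λ { (i ∷ x ∷ y ∷ []) → select i x y }
  branch = rec-computable (λ { (_ ∷ _ ∷ []) → refl }) (λ { _ (_ ∷ _ ∷ []) → refl })
             (var 1F) (var 2F)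

  branch-bit : ∀ c {x y} → select (bit c) x y ≡ (if c then x else y)
  branch-bit true  = refl
  branch-bit false = refl

≤ᵇ-computable : IsComputable₂ᵇ _≤ᵇ_
≤ᵇ-computable = toBits (ap₂ ∸-computable (lit 1) (ap₂ ∸-computable (var 0F) (var 1F))) eq
  where
  eq : ∀ m n → 1 ∸ (m ∸ n) ≡ bit (m ≤ᵇ n)
  eq zero          n       = cong (1 ∸_) (0∸n≡0 n)
  eq (suc m)       zero    = 0∸n≡0 m
  eq (suc zero)    (suc n) = eq zero n
  eq (suc (suc m)) (suc n) = eq (suc m) n

≡ᵇ-computable : IsComputable₂ᵇ _≡ᵇ_
≡ᵇ-computable = toBits
  (ap₂ ∸-computable (lit 1)
    (ap₂ +-computable (ap₂ ∸-computable (var 0F) (var 1F)) (ap₂ ∸-computable (var 1F) (var 0F))))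
  eq
  where
  eq : ∀ m n → 1 ∸ ((m ∸ n) + (n ∸ m)) ≡ bit (m ≡ᵇ n)
  eq zero    zero    = refl
  eq zero    (suc n) = 0∸n≡0 n
  eq (suc m) zero    = 0∸n≡0 (m + 0)
  eq (suc m) (suc n) = eq m n

module _ {a b : ℕ → ℕ → ℕ} (ca : IsComputable₂ a) (cb : IsComputable₂ b) where

  private
    a′ : IsComputable {2} (λ xs → a (lookup xs 0F) (lookup xs 1F))
    a′ = ap₂ ca (var 0F) (var 1F)

    b′ : IsComputable {2} (λ xs → b (lookup xs 0F) (lookup xs 1F))
    b′ = ap₂ cb (var 0F) (var 1F)

  ≤-test : IsComputable₂ᵇ (λ x y → a x y ≤ᵇ b x y)
  ≤-test = toBits (ap₂ (ofBits ≤ᵇ-computable) a′ b′) (λ _ _ → refl)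

  ≡-test : IsComputable₂ᵇ (λ x y → a x y ≡ᵇ b x y)
  ≡-test = toBits (ap₂ (ofBits ≡ᵇ-computable) a′ b′) (λ _ _ → refl)

if-test : {b : ℕ → ℕ → Bool} {t e : Vec ℕ 2 → ℕ} → IsComputable₂ᵇ b →
          IsComputable t → IsComputable e →
          IsComputable (λ xs → if b (lookup xs 0F) (lookup xs 1F) then t xs else e xs)
if-test cb = if-computable (ap₂ (ofBits cb) (var 0F) (var 1F))

not-computable : {a : ℕ → ℕ → Bool} → IsComputable₂ᵇ a → IsComputable₂ᵇ (λ x y → not (a x y))
not-computable {a} ca = toBits (if-test ca (lit 0) (lit 1)) (λ x y → eq (a x y))
  where
  eq : ∀ c → (if c then 0 else 1) ≡ bit (not c)
  eq true  = refl
  eq false = refl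

module _ {a b : ℕ → ℕ → Bool} (ca : IsComputable₂ᵇ a) (cb : IsComputable₂ᵇ b) where

  ∧-computable : IsComputable₂ᵇ (λ x y → a x y ∧ b x y)
  ∧-computable = toBits (if-test ca (ap₂ (ofBits cb) (var 0F) (var 1F)) (lit 0))
    (λ x y → eq (a x y))
    where
    eq : ∀ c {d} → (if c then bit d else 0) ≡ bit (c ∧ d)
    eq true  = refl
    eq false = refl

  ∨-computable : IsComputable₂ᵇ (λ x y → a x y ∨ b x y)
  ∨-computable = toBits (if-test ca (lit 1) (ap₂ (ofBits cb) (var 0F) (var 1F)))
    (λ x y → eq (a x y))
    where
    eq : ∀ c {d} → (if c then 1 else bit d) ≡ bit (c ∨ d)
    eq true  = refl
    eq false = refl

-- For increasing h with h 0 = 0, level h j is the n with h n ≤ j < h (suc n)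
level : (ℕ → ℕ) → ℕ → ℕ
level h zero    = zero
level h (suc j) = if h (suc (level h j)) ≤ᵇ suc j then suc (level h j) else level h j

level-computable : ∀ {h} → IsComputable₁ h → IsComputable₁ (level h)
level-computable {h} ch = rec-computable (λ { [] → refl }) (λ { _ [] → refl }) (lit 0)
  (if-computable {b = λ { (j ∷ l ∷ []) → h (suc l) ≤ᵇ suc j }}
    (computable-cong (λ { (_ ∷ _ ∷ []) → refl })
      (ap₂ (ofBits ≤ᵇ-computable) (ap₁ ch (sucᵖ (var 1F))) (sucᵖ (var 0F))))
    (sucᵖ (var 1F)) (var 1F))

module _ {h : ℕ → ℕ} (h0 : h 0 ≡ 0) (h-mono : ∀ n → h n < h (suc n)) where

  step⇒mono-< : ∀ {m n} → m < n → h m < h n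
  step⇒mono-< {m} {suc n} m<1+n with m<1+n⇒m<n∨m≡n m<1+n
  ... | inj₁ m<n  = <-trans (step⇒mono-< m<n) (h-mono n)
  ... | inj₂ refl = h-mono n

  step⇒mono-≤ : ∀ {m n} → m ≤ n → h m ≤ h n
  step⇒mono-≤ m≤n with m≤n⇒m<n∨m≡n m≤n
  ... | inj₁ m<n  = <⇒≤ (step⇒mono-< m<n)
  ... | inj₂ refl = ≤-refl

  level-bounds : ∀ j → h (level h j) ≤ j × j < h (suc (level h j))
  level-bounds zero = ≤-reflexive h0 , subst (_< h 1) h0 (h-mono 0)
  level-bounds (suc j)
    with level-bounds j | h (suc (level h j)) ≤ᵇ suc j | ≤ᵇ-reflects-≤ (h (suc (level h j))) (suc j)
  ... | _ , j<  | true  | ofʸ h≤ = h≤ , <-≤-trans (s≤s j<) (h-mono _)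
  ... | ≤j , _  | false | ofⁿ h≰ = m≤n⇒m≤1+n ≤j , ≰⇒> h≰

  level-unique : ∀ {j n} → h n ≤ j → j < h (suc n) → level h j ≡ n
  level-unique {j} {n} hn≤j j<hn with <-cmp (level h j) n | level-bounds j
  ... | tri≈ _ eq _ | _      = eq
  ... | tri< l<n _ _ | _ , j< = ⊥-elim (<⇒≱ j< (≤-trans (step⇒mono-≤ l<n) hn≤j))
  ... | tri> _ _ n<l | ≤j , _ = ⊥-elim (<⇒≱ j<hn (≤-trans (step⇒mono-≤ n<l) ≤j))

-- Pairing

square : ℕ → ℕ
square n = n * n

square-mono : ∀ n → square n < square (suc n)
square-mono n = *-mono-< (n<1+n n) (n<1+n n)

root π₁ π₂ : ℕ → ℕ
root  = level square
π₁ n = n ∸ square (root n)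
π₂ n = root n ∸ π₁ n

-- Only pair is inverted by π₁ and π₂: pair (π₁ n) (π₂ n) ≡ n fails when
-- root n < π₁ n, where π₂ truncates to 0.
pair : ℕ → ℕ → ℕ
pair x y = square (x + y) + x

root-pair : ∀ x y → root (pair x y) ≡ x + y
root-pair x y = level-unique refl square-mono (m≤m+n (square (x + y)) x) (begin-strict
  square (x + y) + x                       ≤⟨ +-monoʳ-≤ (square (x + y)) (m≤m+n x y) ⟩
  square (x + y) + (x + y)                 <⟨ m<m+n _ {suc (x + y)} z<s ⟩
  square (x + y) + (x + y) + suc (x + y)   ≡⟨ eq (x + y) ⟩
  square (suc (x + y))                     ∎)
  where
  open ≤-Reasoning
  eq : ∀ n → n * n + n + suc n ≡ suc n * suc n
  eq = solve-∀

π₁-pair : ∀ x y → π₁ (pair x y) ≡ x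
π₁-pair x y rewrite root-pair x y = m+n∸m≡n (square (x + y)) x

π₂-pair : ∀ x y → π₂ (pair x y) ≡ y
π₂-pair x y rewrite π₁-pair x y | root-pair x y = m+n∸m≡n x y

x≤pair : ∀ x y → x ≤ pair x y
x≤pair x y = m≤n+m x (square (x + y))

-- `root n ≤ π₁ n + π₂ n` holds even where `π₂` truncates. Hence only finitely many codes, pairs or
-- not, have both components small.
unpair-bound : ∀ n → n < square (suc (π₁ n + π₂ n))
unpair-bound n = <-≤-trans (proj₂ (level-bounds refl square-mono n))
  (step⇒mono-≤ refl square-mono (s≤s (m≤n+m∸n (root n) (π₁ n))))

square-computable : IsComputable₁ square
square-computable = fun₁ (ap₂ *-computable (var 0F) (var 0F)) (λ _ → refl)

root-computable : IsComputable₁ root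
root-computable = level-computable square-computable

π₁-computable : IsComputable₁ π₁
π₁-computable = fun₁
  (ap₂ ∸-computable (var 0F) (ap₁ square-computable (ap₁ root-computable (var 0F))))
  (λ _ → refl)

π₂-computable : IsComputable₁ π₂
π₂-computable = fun₁
  (ap₂ ∸-computable (ap₁ root-computable (var 0F)) (ap₁ π₁-computable (var 0F)))
  (λ _ → refl)

-- Co-c.e. sets

module _ {X : SetOfℕ} {R : ℕ → ℕ → Bool} (cR : IsComputable₂ᵇ R)
         (spec : ∀ x → X x ≡ false ⇔ (∃[ t ] R x t ≡ true)) where

  -- The enumeration dovetails over all pairs `(x , t)`. A range is never empty, so a known
  -- non-member of `X` serves as default output.
  coCE-projection : ∃[ x ] X x ≡ false → IsCoCE X
  coCE-projection (x₀ , x₀∉X) = inj₂ (f , f-computable , λ x → mk⇔ (complete x) (sound x))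
    where
    f : ℕ → ℕ
    f n = if R (π₁ n) (π₂ n) then π₁ n else x₀

    f-computable : IsComputable₁ f
    f-computable = fun₁
      (if-computable {b = λ { (n ∷ []) → R (π₁ n) (π₂ n) }}
        (computable-cong (λ { (_ ∷ []) → refl })
          (ap₂ (ofBits cR) (ap₁ π₁-computable (var 0F)) (ap₁ π₂-computable (var 0F))))
        (ap₁ π₁-computable (var 0F)) (lit x₀))
      (λ _ → refl)

    complete : ∀ x → ∁ X x ≡ true → ∃[ n ] f n ≡ x
    complete x x∉X with t , Rxt ← Equivalence.to (spec x) (not-injective x∉X) =
      pair x t , trans (cong₂ (λ y s → if R y s then y else x₀) (π₁-pair x t) (π₂-pair x t))
                       (cong (if_then x else x₀) Rxt)

    sound : ∀ x → ∃[ n ] f n ≡ x → ∁ X x ≡ true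
    sound x (n , refl) with R (π₁ n) (π₂ n) in Rn
    ... | true  = cong not (Equivalence.from (spec _) (π₂ n , Rn))
    ... | false = cong not x₀∉X

  private
    alive : ℕ → ℕ → Bool
    alive x zero    = true
    alive x (suc s) = alive x s ∧ not (R x s)

    -- The delay by one stage gives the required value `false` at stage 0, at the cost of one change
    -- there.
    guess : ℕ → ℕ → Bool
    guess x zero    = false
    guess x (suc s) = alive x s

    guess-computable : IsComputable₂ᵇ guess
    guess-computable = toBits (ap₂ flipped (var 1F) (var 0F)) (λ _ _ → refl)
      where
      alive-flipped : IsComputable₂ (λ s x → bit (alive x s))
      alive-flipped = rec-computable
        {h = λ { (s ∷ a ∷ x ∷ []) → if a ≤ᵇ 0 then 0 else (if R x s then 0 else 1) }}
        (λ { (_ ∷ []) → refl }) (λ { s (x ∷ []) → eq (alive x s) (R x s) })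
        (lit 1)
        (computable-cong (λ { (_ ∷ _ ∷ _ ∷ []) → refl })
          (if-computable {b = λ { (s ∷ a ∷ x ∷ []) → a ≤ᵇ 0 }}
            (computable-cong (λ { (_ ∷ _ ∷ _ ∷ []) → refl }) (ap₂ (ofBits ≤ᵇ-computable) (var 1F) (lit 0)))
            (lit 0)
            (if-computable {b = λ { (s ∷ a ∷ x ∷ []) → R x s }}
              (computable-cong (λ { (_ ∷ _ ∷ _ ∷ []) → refl }) (ap₂ (ofBits cR) (var 2F) (var 0F)))
              (lit 0) (lit 1))))
        where
        eq : ∀ a r → bit (a ∧ not r) ≡ (if bit a ≤ᵇ 0 then 0 else (if r then 0 else 1))
        eq true  true  = refl
        eq true  false = refl
        eq false _     = refl

      flipped : IsComputable₂ (λ s x → bit (guess x s))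
      flipped = rec-computable {h = λ { (s ∷ _ ∷ x ∷ []) → bit (alive x s) }}
        (λ { (_ ∷ []) → refl }) (λ { _ (_ ∷ []) → refl }) (lit 0)
        (computable-cong (λ { (_ ∷ _ ∷ _ ∷ []) → refl }) (ap₂ alive-flipped (var 0F) (var 2F)))

    dead-stays : ∀ {x s t} → s ≤ t → alive x s ≡ false → alive x t ≡ false
    dead-stays {x} {t = t} s≤t dead with m≤n⇒m<n∨m≡n s≤t
    ... | inj₂ refl = dead
    dead-stays {x} {t = suc t} s≤t dead | inj₁ (s≤s s≤t′) =
      cong (_∧ not (R x t)) (dead-stays {x} s≤t′ dead)

    Step : ℕ → ℕ → Set
    Step x s = alive x s ≡ true × alive x (suc s) ≡ false

    -- Walks back from a dead stage; the walk stops because stage 0 is alive.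
    death : ∀ x s → alive x s ≡ false → ∃[ t ] Step x t
    death x (suc s) dead with alive x s in a
    ... | true  = s , a , trans (cong (_∧ not (R x s)) a) dead
    ... | false = death x s a

    step-unique : ∀ {x s t} → Step x s → Step x t → s ≡ t
    step-unique {x} {s} {t} (aₛ , dₛ) (aₜ , dₜ) with <-cmp s t
    ... | tri≈ _ s≡t _ = s≡t
    ... | tri< s<t _ _ = contradiction (trans (sym aₜ) (dead-stays {x} s<t dₛ)) λ ()
    ... | tri> _ _ t<s = contradiction (trans (sym aₛ) (dead-stays {x} t<s dₜ)) λ ()

    change-step : ∀ {x s} → alive x s ≢ alive x (suc s) → Step x s
    change-step {x} {s} ≢ with alive x s
    ... | true  = refl , ¬-not (≢ ∘ sym)
    ... | false = contradiction refl ≢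

    member-alive : ∀ {x} → X x ≡ true → ∀ s → alive x s ≡ true
    member-alive x∈X zero = refl
    member-alive {x} x∈X (suc s) with R x s in Rxs
    ... | false = cong (_∧ true) (member-alive x∈X s)
    ... | true  = contradiction (trans (sym x∈X) (Equivalence.from (spec x) (s , Rxs))) λ ()

    nonmember-dead : ∀ {x} → X x ≡ false → ∃[ s ] alive x s ≡ false
    nonmember-dead {x} x∉X with t , Rxt ← Equivalence.to (spec x) x∉X =
      suc t , trans (cong (λ r → alive x t ∧ not r) Rxt) (∧-zeroʳ (alive x t))

  -- Every `x` enters at stage 0. A non-member changes once more, at the delayed image of its only
  -- `Step`.
  coprojection-nce : ∀ {n} → 2 ≤ n → IsNCE n X
  coprojection-nce {n} 2≤n = record
    { g          = guess
    ; computable = guess-computable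
    ; initial    = λ _ → refl
    ; limit      = limit
    ; changes    = changes
    }
    where
    limit : ∀ x → ∃[ s₀ ] (∀ s → s₀ ≤ s → guess x s ≡ X x)
    limit x with X x in Xx
    ... | true  = 1 , λ { (suc s) _ → member-alive Xx s }
    ... | false with t , dead ← nonmember-dead Xx =
      suc t , λ { (suc s) (s≤s t≤s) → dead-stays {x} t≤s dead }

    changes : ∀ x → HasAtMost n (λ s → guess x s ≢ guess x (suc s))
    changes x with X x in Xx
    ... | true  = 0 ∷ [] , ≤-trans (s≤s z≤n) 2≤n , λ
      { {zero}  _ → here refl
      ; {suc s} ≢ → contradiction (trans (member-alive Xx s) (sym (member-alive Xx (suc s)))) ≢
      }
    ... | false with t₀ , dead ← nonmember-dead Xx with t , step ← death x t₀ dead =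
      0 ∷ suc t ∷ [] , 2≤n , λ
        { {zero}  _ → here refl
        ; {suc s} ≢ → there (here (cong suc (step-unique {x} (change-step {x} ≢) step)))
        }

coCE⇒nCE : ∀ {B n} → 2 ≤ n → IsCoCE B → IsNCE n B
-- If the complement is empty, the relation that never holds projects to it.
coCE⇒nCE {B} 2≤n (inj₁ all∈) = coprojection-nce {R = λ _ _ → false}
  (toBits (lit 0) (λ _ _ → refl))
  (λ x → mk⇔ (λ x∉ → contradiction (trans (sym (cong not x∉)) (all∈ x)) λ ()) λ ())
  2≤n
coCE⇒nCE {B} 2≤n (inj₂ (f , cf , enum)) = coprojection-nce {R = λ x s → f s ≡ᵇ x}
  (≡-test (fun₂ (ap₁ cf (var 1F)) (λ _ _ → refl)) (fun₂ (var 0F) (λ _ _ → refl)))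
  (λ x → mk⇔ (to x) (from x))
  2≤n
  where
  to : ∀ x → B x ≡ false → ∃[ s ] (f s ≡ᵇ x) ≡ true
  to x x∉ with s , refl ← Equivalence.to (enum x) (cong not x∉) = s , dec-true (x ≟ x) refl

  from : ∀ x → ∃[ s ] (f s ≡ᵇ x) ≡ true → B x ≡ false
  from x (s , eq) = not-injective (Equivalence.from (enum x)
    (s , ≡ᵇ⇒≡ (f s) x (subst T (sym eq) _)))

-- Counting

module _ (X : SetOfℕ) where

  count-suc : ∀ m → count X (suc m) ≡ count X m + bit (X m)
  count-suc m = begin
    length (filterᵇ X (upTo (suc m)))                     ≡⟨ cong (length ∘ filterᵇ X) (upTo-∷ʳ m) ⟨
    length (filterᵇ X (upTo m ∷ʳ m))                      ≡⟨ cong length (filter-++ (T? ∘ X) (upTo m) (m ∷ [])) ⟩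
    length (filterᵇ X (upTo m) ++ filterᵇ X (m ∷ []))     ≡⟨ length-++ (filterᵇ X (upTo m)) ⟩
    count X m + length (filterᵇ X (m ∷ []))               ≡⟨ cong (count X m +_) singleton ⟩
    count X m + bit (X m)                                 ∎
    where
    open ≡-Reasoning
    singleton : length (filterᵇ X (m ∷ [])) ≡ bit (X m)
    singleton with X m
    ... | true  = refl
    ... | false = refl

  count≤ : ∀ m → count X m ≤ m
  count≤ zero    = z≤n
  count≤ (suc m) rewrite count-suc m with X m
  ... | true  = ≤-trans (≤-reflexive (+-comm _ 1)) (s≤s (count≤ m))
  ... | false = m≤n⇒m≤1+n (≤-trans (≤-reflexive (+-identityʳ _)) (count≤ m))

  count-empty : ∀ {l m} → l ≤ m → (∀ j → l ≤ j → j < m → X j ≡ false) → count X m ≡ count X l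
  count-empty {l} {m} l≤m ∉X with m≤n⇒m<n∨m≡n l≤m
  ... | inj₂ refl = refl
  count-empty {l} {suc m} _ ∉X | inj₁ (s≤s l≤m)
    rewrite count-suc m | ∉X m l≤m (n<1+n m) =
    trans (+-identityʳ _) (count-empty l≤m λ j l≤j j<m → ∉X j l≤j (m<n⇒m<1+n j<m))

  count-full : ∀ {l m} → l ≤ m → (∀ j → l ≤ j → j < m → X j ≡ true) →
               count X m ≡ count X l + (m ∸ l)
  count-full {l} {m} l≤m ∈X with m≤n⇒m<n∨m≡n l≤m
  ... | inj₂ refl = sym (trans (cong (count X l +_) (n∸n≡0 l)) (+-identityʳ _))
  count-full {l} {suc m} _ ∈X | inj₁ (s≤s l≤m)
    rewrite count-suc m | ∈X m l≤m (n<1+n m) | +-∸-assoc 1 l≤m =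
    trans (cong (_+ 1) (count-full l≤m λ j l≤j j<m → ∈X j l≤j (m<n⇒m<1+n j<m)))
          (trans (+-assoc (count X l) (m ∸ l) 1) (cong (count X l +_) (+-comm (m ∸ l) 1)))

count-cong : ∀ {X Y} m → (∀ i → i < m → X i ≡ Y i) → count X m ≡ count Y m
count-cong zero    X≗Y = refl
count-cong {X} {Y} (suc m) X≗Y rewrite count-suc X m | count-suc Y m =
  cong₂ _+_ (count-cong m λ i i<m → X≗Y i (m<n⇒m<1+n i<m)) (cong bit (X≗Y m (n<1+n m)))

count-computable : ∀ {g : ℕ → ℕ → Bool} → IsComputable₂ᵇ g →
                   IsComputable₂ (λ m s → count (λ i → g i s) m)
count-computable {g} cg = rec-computable
  {h = λ { (m ∷ c ∷ s ∷ []) → c + bit (g m s) }}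
  (λ { (_ ∷ []) → refl }) (λ { m (s ∷ []) → count-suc (λ i → g i s) m })
  (lit 0)
  (computable-cong (λ { (_ ∷ _ ∷ _ ∷ []) → refl })
    (ap₂ +-computable (var 1F) (ap₂ (ofBits cg) (var 0F) (var 2F))))

-- Eventually ρ X m ≤ p / d.
DensityBound : SetOfℕ → ℕ → ℕ → Set
DensityBound X p d = ∃[ N ] (∀ m → N ≤ m → count X m * d ≤ p * m)

-- By integrality, `p / d < p′ / d′` leaves a gap of at least `1 / (d * d′)`, which absorbs the
-- extra 1 in the numerator.
density-weaken : ∀ {X p d p′ d′} .{{_ : NonZero d}} → p * d′ < p′ * d →
                 DensityBound X (suc (p * d′)) (d * d′) → DensityBound X p′ d′
density-weaken {X} {p} {d} {p′} {d′} lt (N , ub) = N , λ m N≤m →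
  *-cancelʳ-≤ (count X m * d′) (p′ * m) d (begin
    count X m * d′ * d        ≡⟨ eq₁ (count X m) d′ d ⟩
    count X m * (d * d′)      ≤⟨ ub m N≤m ⟩
    suc (p * d′) * m          ≤⟨ *-monoˡ-≤ m lt ⟩
    p′ * d * m                ≡⟨ eq₂ p′ d m ⟩
    p′ * m * d                ∎)
  where
  open ≤-Reasoning
  eq₁ : ∀ x y z → x * y * z ≡ x * (z * y)
  eq₁ = solve-∀
  eq₂ : ∀ x y z → x * y * z ≡ x * z * y
  eq₂ = solve-∀

-- Blocks

-- The n-th block is [boundary n , boundary (suc n)). Its right end is a multiple
-- of k + 1, so that the density c / (k + 1) is attained there by slack n * c
-- elements, and is at least n + 1 times its left end.
boundary slack : ℕ → ℕ
boundary zero    = 0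
boundary (suc n) = suc (π₁ n) * (suc n * suc (boundary n))
slack n = suc n * suc (boundary n)

slack≤boundary : ∀ n → slack n ≤ boundary (suc n)
slack≤boundary n = m≤n*m (slack n) (suc (π₁ n))

-- All that precedes block `n` is at most a fraction `1 / e` of `slack n`, hence of the right end;
-- the error terms below are absorbed in this way.
*-boundary≤slack : ∀ {e n} → e ≤ suc n → boundary n * e ≤ slack n
*-boundary≤slack {e} {n} e≤ = ≤-trans (≤-reflexive (*-comm (boundary n) e)) (*-mono-≤ e≤ (n≤1+n (boundary n)))

boundary-mono : ∀ n → boundary n < boundary (suc n)
boundary-mono n = ≤-trans (m≤n*m (suc (boundary n)) (suc n)) (slack≤boundary n)

n≤boundary : ∀ n → n ≤ boundary n
n≤boundary zero    = z≤n
n≤boundary (suc n) = ≤-<-trans (n≤boundary n) (boundary-mono n)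

block : ℕ → ℕ
block = level boundary

boundary-block : ∀ j → boundary (block j) ≤ j × j < boundary (suc (block j))
boundary-block = level-bounds refl boundary-mono

≤block : ∀ {n j} → boundary n ≤ j → n ≤ block j
≤block {n} {j} b≤j = ≮⇒≥ λ l<n →
  <⇒≱ (proj₂ (boundary-block j)) (≤-trans (step⇒mono-≤ refl boundary-mono l<n) b≤j)

boundary-computable : IsComputable₁ boundary
boundary-computable = rec-computable
  {h = λ { (n ∷ b ∷ []) → suc (π₁ n) * (suc n * suc b) }}
  (λ { [] → refl }) (λ { _ [] → refl }) (lit 0)
  (computable-cong (λ { (_ ∷ _ ∷ []) → refl })
    (ap₂ *-computable (sucᵖ (ap₁ π₁-computable (var 0F)))
      (ap₂ *-computable (sucᵖ (var 0F)) (sucᵖ (var 1F)))))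

slack-computable : IsComputable₁ slack
slack-computable = fun₁
  (ap₂ *-computable (sucᵖ (var 0F)) (sucᵖ (ap₁ boundary-computable (var 0F)))) (λ _ → refl)

block-computable : IsComputable₁ block
block-computable = level-computable boundary-computable

-- The running density decreases while X is empty and increases while X is
-- full, so on such a segment it is largest at one of the two ends.
module _ {X : SetOfℕ} {l c r : ℕ} (l≤c : l ≤ c) (c≤r : c ≤ r)
         (empty : ∀ j → l ≤ j → j < c → X j ≡ false)
         (full : ∀ j → c ≤ j → j < r → X j ≡ true) where

  count-segment : count X r ≡ count X l + (r ∸ c)
  count-segment = trans (count-full X c≤r full) (cong (_+ (r ∸ c)) (count-empty X l≤c empty))

  segment-bound : ∀ p d m → count X l * d ≤ p * l → count X r * d ≤ p * r →
                  l ≤ m → m ≤ r → count X m * d ≤ p * m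
  segment-bound p d m at-l at-r l≤m m≤r with ≤-total m c
  ... | inj₁ m≤c = begin
    count X m * d  ≡⟨ cong (_* d) (count-empty X l≤m λ j l≤j j<m → empty j l≤j (<-≤-trans j<m m≤c)) ⟩
    count X l * d  ≤⟨ at-l ⟩
    p * l          ≤⟨ *-monoʳ-≤ p l≤m ⟩
    p * m          ∎
    where open ≤-Reasoning
  ... | inj₂ c≤m with ≤-total d p
  -- A bound of at least 1 holds for every density.
  ...   | inj₁ d≤p = begin
    count X m * d  ≤⟨ *-mono-≤ (count≤ X m) d≤p ⟩
    m * p          ≡⟨ *-comm m p ⟩
    p * m          ∎
    where open ≤-Reasoning
  -- From `m` to `r` the left side grows by `(r ∸ m) * d` and the right side by no more, so the
  -- bound at `r` pulls back to `m`.
  ...   | inj₂ p≤d = +-cancelʳ-≤ ((r ∸ m) * d) _ _ (begin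
    count X m * d + (r ∸ m) * d  ≡⟨ *-distribʳ-+ d (count X m) (r ∸ m) ⟨
    (count X m + (r ∸ m)) * d    ≡⟨ cong (_* d) (count-full X m≤r λ j m≤j → full j (≤-trans c≤m m≤j)) ⟨
    count X r * d                ≤⟨ at-r ⟩
    p * r                        ≡⟨ cong (p *_) (m+[n∸m]≡n m≤r) ⟨
    p * (m + (r ∸ m))            ≡⟨ *-distribˡ-+ p m (r ∸ m) ⟩
    p * m + p * (r ∸ m)          ≤⟨ +-monoʳ-≤ (p * m) (*-monoˡ-≤ (r ∸ m) p≤d) ⟩
    p * m + d * (r ∸ m)          ≡⟨ cong (p * m +_) (*-comm d (r ∸ m)) ⟩
    p * m + (r ∸ m) * d          ∎)
    where open ≤-Reasoning

-- Correct guesses about the prefixes of `A`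

module Construction
  {A : SetOfℕ} {g : ℕ → ℕ → Bool} (g-computable : IsComputable₂ᵇ g)
  (g-initial : ∀ x → g x 0 ≡ false)
  (g-limit : ∀ x → ∃[ s₀ ] (∀ s → s₀ ≤ s → g x s ≡ A x))
  where

  stageCount : ℕ → ℕ → ℕ
  stageCount k s = count (λ i → g i s) (suc k)

  modulus : ℕ → ℕ
  modulus zero    = 0
  modulus (suc m) = modulus m ⊔ proj₁ (g-limit m)

  modulus-mono : ∀ {m n} → m ≤ n → modulus m ≤ modulus n
  modulus-mono {m} {n} m≤n with m≤n⇒m<n∨m≡n m≤n
  ... | inj₂ refl = ≤-refl
  modulus-mono {m} {suc n} _ | inj₁ (s≤s m≤n) = ≤-trans (modulus-mono m≤n) (m≤m⊔n _ _)

  settled : ∀ k {s} → modulus (suc k) ≤ s → stageCount k s ≡ count A (suc k)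
  settled k M≤s = count-cong (suc k) λ i i<1+k →
    proj₂ (g-limit i) _ (≤-trans (m≤n⊔m (modulus i) _) (≤-trans (modulus-mono i<1+k) M≤s))

  -- A guess (k , s) must also name the least correct stage; otherwise each k
  -- would be met infinitely often.
  Fresh : ℕ → ℕ → Set
  Fresh k s = s ≡ 0 ⊎ stageCount k (pred s) ≢ stageCount k s

  fresh? : ∀ k s → Dec (Fresh k s)
  fresh? k s = (s ≟ 0) ⊎-dec ¬? (stageCount k (pred s) ≟ stageCount k s)

  -- For fixed `t` this is a finite test. A guess is correct when it passes for all `t`, so
  -- incorrectness is found by search.
  Valid : ℕ → ℕ → Set
  Valid n t = Fresh (π₁ n) (π₂ n) × stageCount (π₁ n) (π₂ n) ≡ stageCount (π₁ n) (π₂ n + t)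

  valid? : ∀ n t → Dec (Valid n t)
  valid? n t = fresh? (π₁ n) (π₂ n) ×-dec
               (stageCount (π₁ n) (π₂ n) ≟ stageCount (π₁ n) (π₂ n + t))

  -- From stage `M` on the count is constant, so the finitely many tests with `t ≤ M` settle the
  -- unbounded question.
  valid-or-refuted : ∀ n → (∀ t → Valid n t) ⊎ (∃[ t ] ¬ Valid n t)
  valid-or-refuted n with anyUpTo? (λ t → ¬? (valid? n t)) (suc (modulus (suc (π₁ n))))
  ... | yes (t , _ , refuted) = inj₂ (t , refuted)
  ... | no  ∄refuted          = inj₁ valid
    where
    M : ℕ
    M = modulus (suc (π₁ n))

    valid-below : ∀ t → t ≤ M → Valid n t
    valid-below t t≤M = decidable-stable (valid? n t) λ ¬v → ∄refuted (t , s≤s t≤M , ¬v)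

    valid : ∀ t → Valid n t
    valid t with ≤-total t M
    ... | inj₁ t≤M = valid-below t t≤M
    ... | inj₂ M≤t with fresh , stable ← valid-below M ≤-refl =
      fresh , trans stable (trans (settled (π₁ n) (m≤n+m M (π₂ n)))
                                  (sym (settled (π₁ n) (≤-trans M≤t (m≤n+m t (π₂ n))))))

  valid-count : ∀ n → (∀ t → Valid n t) → stageCount (π₁ n) (π₂ n) ≡ count A (suc (π₁ n))
  valid-count n valid = trans (proj₂ (valid M)) (settled (π₁ n) (m≤n+m M (π₂ n)))
    where
    M : ℕ
    M = modulus (suc (π₁ n))

  -- If a stage `suc s` exceeded the modulus, `s` would have reached it too; both counts would be
  -- settled and equal, against freshness.
  valid-stage : ∀ n → (∀ t → Valid n t) → π₂ n ≤ modulus (suc (π₁ n))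
  valid-stage n valid with π₂ n | proj₁ (valid 0)
  ... | zero  | _            = z≤n
  ... | suc s | inj₂ changed = ≮⇒≥ λ M<1+s → changed
    (trans (settled (π₁ n) (≤-pred M<1+s)) (sym (settled (π₁ n) (<⇒≤ M<1+s))))

  -- If `suc (π₁ n) ≤ N`, then `valid-stage` bounds `π₂ n` by `modulus N`, and `unpair-bound` bounds
  -- `n`. So short prefixes of `A` influence only finitely many blocks.
  valid-finite : ∀ N → ∃[ M ] (∀ n → M ≤ n → (∀ t → Valid n t) → N < suc (π₁ n))
  valid-finite N = square (suc (N + modulus N)) , λ n M≤n valid → ≰⇒> λ k<N →
    <⇒≱ (unpair-bound n) (≤-trans
      (step⇒mono-≤ refl square-mono
        (s≤s (+-mono-≤ (<⇒≤ k<N) (≤-trans (valid-stage n valid) (modulus-mono k<N)))))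
      M≤n)

  -- Steps back from a stable stage while the preceding count agrees; stability is kept, and the
  -- stopping point is fresh.
  first-stage : ∀ k s → (∀ t → stageCount k s ≡ stageCount k (s + t)) →
                ∃[ s′ ] Fresh k s′ × (∀ t → stageCount k s′ ≡ stageCount k (s′ + t))
  first-stage k zero    stable = 0 , inj₁ refl , stable
  first-stage k (suc s) stable with stageCount k s ≟ stageCount k (suc s)
  ... | no  changed = suc s , inj₂ changed , stable
  ... | yes same    = first-stage k s λ t → trans same (trans (stable t) (later t))
    where
    later : ∀ t → stageCount k (suc s + t) ≡ stageCount k (s + t)
    later zero    = trans (cong (stageCount k) (+-identityʳ (suc s)))
                      (trans (sym same) (cong (stageCount k) (sym (+-identityʳ s))))
    later (suc t) = trans (sym (stable (suc t)))
                      (trans (stable t) (cong (stageCount k) (sym (+-suc s t))))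

  -- The bound `k ≤ n` puts long prefixes into late blocks, where the error is small.
  valid-exists : ∀ k → ∃[ n ] k ≤ n × π₁ n ≡ k × (∀ t → Valid n t)
  valid-exists k
    with s , fresh , stable ← first-stage k (modulus (suc k))
           (λ t → trans (settled k ≤-refl) (sym (settled k (m≤m+n (modulus (suc k)) t)))) =
    pair k s , x≤pair k s , π₁-pair k s ,
    λ t → subst₂ (λ k s → Fresh k s × stageCount k s ≡ stageCount k (s + t))
            (sym (π₁-pair k s)) (sym (π₂-pair k s)) (fresh , stable t)

  -- The co-c.e. set `B`

  width : ℕ → ℕ
  width n = slack n * stageCount (π₁ n) (π₂ n)

  width≤boundary : ∀ n → width n ≤ boundary (suc n)
  width≤boundary n = ≤-trans (*-monoʳ-≤ (slack n) (count≤ (λ i → g i (π₂ n)) (suc (π₁ n))))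
                       (≤-reflexive (*-comm (slack n) (suc (π₁ n))))

  Late : ℕ → ℕ → Set
  Late n j = boundary (suc n) ≤ j + width n

  late? : ∀ n j → Dec (Late n j)
  late? n j = boundary (suc n) ≤? j + width n

  -- The case distinction rests on `g-limit`, so this definition gives no algorithm. Computability
  -- enters through `reject`, which looks at one `t` at a time.
  B : SetOfℕ
  B j with valid-or-refuted (block j)
  ... | inj₁ _ = does (late? (block j) j)
  ... | inj₂ _ = false

  reject : ℕ → ℕ → Bool
  reject j t = not (does (late? (block j) j ×-dec valid? (block j) t))

  reject-spec : ∀ j → B j ≡ false ⇔ (∃[ t ] reject j t ≡ true)
  reject-spec j = mk⇔ to from
    where
    to : B j ≡ false → ∃[ t ] reject j t ≡ true
    to j∉B with valid-or-refuted (block j)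
    -- Here `Late` fails already, so any `t` would do.
    ... | inj₁ _       = 0 , cong (λ b → not (b ∧ does (valid? (block j) 0))) j∉B
    ... | inj₂ (t , ¬v) = t , cong not (dec-false (late? (block j) j ×-dec valid? (block j) t) (¬v ∘ proj₂))

    from : ∃[ t ] reject j t ≡ true → B j ≡ false
    from (t , rejected) with valid-or-refuted (block j)
    ... | inj₂ _     = refl
    ... | inj₁ valid = dec-false (late? (block j) j) λ late →
      contradiction (trans (sym rejected)
        (cong not (dec-true (late? (block j) j ×-dec valid? (block j) t) (late , valid t)))) λ ()

  reject-computable : IsComputable₂ᵇ reject
  -- `does` of the composite decision reduces to `_≤ᵇ_`, `_≡ᵇ_`, `not`, `_∧_` and `_∨_`, which the
  -- tests below mirror.
  reject-computable = not-computable (∧-computable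
    (≤-test (of₂ (ap₁ boundary-computable (sucᵖ n)))
            (of₂ (ap₂ +-computable (var 0F) (ap₂ *-computable (ap₁ slack-computable n) kₛ))))
    (∧-computable
      (∨-computable (≡-test (of₂ s) (of₂ (lit 0)))
        (not-computable (≡-test
          (of₂ (ap₂ stageCount-computable k (ap₁ pred-computable s))) (of₂ kₛ))))
      (≡-test (of₂ kₛ) (of₂ (ap₂ stageCount-computable k (ap₂ +-computable s (var 1F)))))))
    where
    of₂ : {F : Vec ℕ 2 → ℕ} → IsComputable F → IsComputable₂ (λ x y → F (x ∷ y ∷ []))
    of₂ cF = fun₂ cF (λ _ _ → refl)

    stageCount-computable : IsComputable₂ stageCount
    stageCount-computable = of₂ (ap₂ (count-computable g-computable) (sucᵖ (var 0F)) (var 1F))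

    n : IsComputable {2} (λ xs → block (lookup xs 0F))
    n = ap₁ block-computable (var 0F)

    k : IsComputable {2} (λ xs → π₁ (block (lookup xs 0F)))
    k = ap₁ π₁-computable n

    s : IsComputable {2} (λ xs → π₂ (block (lookup xs 0F)))
    s = ap₁ π₂-computable n

    kₛ : IsComputable {2} (λ xs → stageCount (π₁ (block (lookup xs 0F))) (π₂ (block (lookup xs 0F))))
    kₛ = ap₂ stageCount-computable k s

  B-coCE : IsCoCE B
  B-coCE = coCE-projection reject-computable reject-spec
    -- The non-member is 0: block 0 carries the guess `(0 , 0)`, and `g 0 0` is `false`, so
    -- `width 0` vanishes and 0 is not `Late`.
    (0 , Equivalence.from (reject-spec 0) (0 , cong not (dec-false
      (late? 0 0 ×-dec valid? 0 0) λ (late , _) → <⇒≱ z<s (subst (1 ≤_) width-0 late))))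
    where
    width-0 : width 0 ≡ 0
    width-0 rewrite g-initial 0 = refl

  block-unique : ∀ {n j} → boundary n ≤ j → j < boundary (suc n) → block j ≡ n
  block-unique = level-unique refl boundary-mono

  B-valid : ∀ n {j} → boundary n ≤ j → j < boundary (suc n) → (∀ t → Valid n t) →
            B j ≡ does (late? n j)
  B-valid n {j} n≤j j<n valid with block-unique {n} n≤j j<n
  ... | refl with valid-or-refuted (block j)
  ...   | inj₁ _         = refl
  ...   | inj₂ (t , ¬v) = contradiction (valid t) ¬v

  B-invalid : ∀ n {j} → boundary n ≤ j → j < boundary (suc n) → ∃[ t ] ¬ Valid n t → B j ≡ false
  B-invalid n {j} n≤j j<n (t , ¬v) with block-unique {n} n≤j j<n
  ... | refl with valid-or-refuted (block j)
  ...   | inj₁ valid = contradiction (valid t) ¬v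
  ...   | inj₂ _     = refl

  -- The density of `B` on one block

  module _ (n : ℕ) where

    -- `width n` can exceed the length of the block, for instance when the guessed count is
    -- `suc (π₁ n)` and `boundary n` is positive; hence the maximum.
    cut : ℕ
    cut = boundary n ⊔ (boundary (suc n) ∸ width n)

    cut≤boundary : cut ≤ boundary (suc n)
    cut≤boundary = ⊔-lub (<⇒≤ (boundary-mono n)) (m∸n≤m _ (width n))

    module _ (valid : ∀ t → Valid n t) where

      valid-empty : ∀ j → boundary n ≤ j → j < cut → B j ≡ false
      valid-empty j n≤j j<cut = trans
        (B-valid n n≤j (<-≤-trans j<cut cut≤boundary) valid)
        (dec-false (late? n j) λ late → <⇒≱ j<cut (⊔-lub n≤j
          (m≤n+o⇒m∸n≤o (boundary (suc n)) (width n) (subst (boundary (suc n) ≤_) (+-comm j (width n)) late))))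

      valid-full : ∀ j → cut ≤ j → j < boundary (suc n) → B j ≡ true
      valid-full j cut≤j j<n = trans
        (B-valid n (≤-trans (m≤m⊔n _ _) cut≤j) j<n valid)
        (dec-true (late? n j) (≤-trans (m≤n+m∸n _ (width n)) (≤-trans
          (+-monoʳ-≤ (width n) (≤-trans (m≤n⊔m (boundary n) _) cut≤j))
          (≤-reflexive (+-comm (width n) j)))))

      valid-width : width n ≡ slack n * count A (suc (π₁ n))
      valid-width = cong (slack n *_) (valid-count n valid)

      valid-segment : count B (boundary (suc n)) ≡ count B (boundary n) + (boundary (suc n) ∸ cut)
      valid-segment = count-segment {B} (m≤m⊔n _ _) cut≤boundary valid-empty valid-full

      -- The final part has at most `width n` elements, and at most `boundary n` come from earlier
      -- blocks.
      valid-count≤ : count B (boundary (suc n)) ≤ boundary n + slack n * count A (suc (π₁ n))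
      valid-count≤ = begin
        count B (boundary (suc n))                       ≡⟨ valid-segment ⟩
        count B (boundary n) + (boundary (suc n) ∸ cut)  ≤⟨ +-mono-≤ (count≤ B (boundary n))
                                                             (∸-monoʳ-≤ (boundary (suc n)) (m≤n⊔m (boundary n) _)) ⟩
        boundary n + (boundary (suc n) ∸ (boundary (suc n) ∸ width n))
                                                         ≡⟨ cong (boundary n +_) (m∸[m∸n]≡n (width≤boundary n)) ⟩
        boundary n + width n                             ≡⟨ cong (boundary n +_) valid-width ⟩
        boundary n + slack n * count A (suc (π₁ n))      ∎
        where open ≤-Reasoning

      -- What the maximum in `cut` takes away from the final part lies below `boundary n`.
      valid-count≥ : slack n * count A (suc (π₁ n)) ≤ boundary n + count B (boundary (suc n))
      valid-count≥ = begin
        slack n * count A (suc (π₁ n))                   ≡⟨ valid-width ⟨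
        width n                                          ≡⟨ m∸[m∸n]≡n (width≤boundary n) ⟨
        top ∸ (top ∸ width n)                            ≤⟨ m≤n+m∸n _ (boundary n) ⟩
        boundary n + (top ∸ (top ∸ width n) ∸ boundary n)
          ≡⟨ cong (boundary n +_) (trans (∸-+-assoc top (top ∸ width n) (boundary n))
                                         (cong (top ∸_) (+-comm (top ∸ width n) (boundary n)))) ⟩
        boundary n + (top ∸ (boundary n + (top ∸ width n)))
          ≤⟨ +-monoʳ-≤ (boundary n) (∸-monoʳ-≤ top (m⊔n≤m+n (boundary n) _)) ⟩
        boundary n + (top ∸ cut)                         ≤⟨ +-monoʳ-≤ (boundary n) (m≤n+m _ (count B (boundary n))) ⟩
        boundary n + (count B (boundary n) + (top ∸ cut))  ≡⟨ cong (boundary n +_) valid-segment ⟨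
        boundary n + count B top                         ∎
        where
        open ≤-Reasoning
        top : ℕ
        top = boundary (suc n)

    module _ (refuted : ∃[ t ] ¬ Valid n t) where

      invalid-empty : ∀ j → boundary n ≤ j → j < boundary (suc n) → B j ≡ false
      invalid-empty j n≤j j<n = B-invalid n n≤j j<n refuted

      invalid-count≤ : count B (boundary (suc n)) ≤ boundary n
      invalid-count≤ = ≤-trans
        (≤-reflexive (count-empty B (<⇒≤ (boundary-mono n)) invalid-empty))
        (count≤ B (boundary n))

    block-bound : ∀ p d m → count B (boundary n) * d ≤ p * boundary n →
                  count B (boundary (suc n)) * d ≤ p * boundary (suc n) →
                  boundary n ≤ m → m ≤ boundary (suc n) → count B m * d ≤ p * m
    block-bound p d m = [ (λ valid → segment-bound {B} (m≤m⊔n _ _) cut≤boundary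
                                   (valid-empty valid) (valid-full valid) p d m)
                    -- In a refuted block the empty part reaches the right end and the full part is
                    -- vacuous.
                    , (λ refuted → segment-bound {B} (<⇒≤ (boundary-mono n)) ≤-refl
                                     (invalid-empty refuted)
                                     (λ j ≤j j< → contradiction j< (≤⇒≯ ≤j)) p d m)
                    ]′ (valid-or-refuted n)

  -- The error allowed is `1 / (d * e)`. At the end of a correct block, the block contributes at
  -- most `slack n` times a count obeying the bound for `A`; earlier elements fit into the error,
  -- and `block-bound` covers the interior.
  A-bound⇒B-bound : ∀ p d e → DensityBound A p d → DensityBound B (suc (p * e)) (d * e)
  A-bound⇒B-bound p d e (N , ub) = boundary (suc n₀) , λ m ≤m → bound m (≤block ≤m) (boundary-block m)
    where
    M : ℕ
    M = proj₁ (valid-finite N)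

    -- Past `M` every correct guess concerns a prefix longer than `N`, where `ub` applies; past
    -- `d * e` the earlier blocks are negligible.
    n₀ : ℕ
    n₀ = M ⊔ d * e

    module _ {n : ℕ} (n₀≤n : n₀ ≤ n) where
      open ≤-Reasoning

      σ k c : ℕ
      σ = slack n
      k = suc (π₁ n)
      c = count A k

      d*e≤1+n : d * e ≤ suc n
      d*e≤1+n = ≤-trans (m≤n⊔m M (d * e)) (m≤n⇒m≤1+n n₀≤n)

      at-valid : (∀ t → Valid n t) →
                 count B (boundary (suc n)) * (d * e) ≤ suc (p * e) * boundary (suc n)
      at-valid valid = begin
        count B (boundary (suc n)) * (d * e)    ≤⟨ *-monoˡ-≤ (d * e) (valid-count≤ n valid) ⟩
        (boundary n + σ * c) * (d * e)          ≡⟨ eq₁ (boundary n) σ c d e ⟩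
        boundary n * (d * e) + σ * e * (c * d)  ≤⟨ +-mono-≤ (*-boundary≤slack d*e≤1+n)
                                                     (*-monoʳ-≤ (σ * e) (ub k (<⇒≤ N<k))) ⟩
        σ + σ * e * (p * k)                     ≤⟨ +-monoˡ-≤ _ (slack≤boundary n) ⟩
        boundary (suc n) + σ * e * (p * k)      ≡⟨ cong (boundary (suc n) +_) (eq₂ σ e p k) ⟩
        suc (p * e) * boundary (suc n)          ∎
        where
        N<k : N < k
        N<k = proj₂ (valid-finite N) n (≤-trans (m≤m⊔n M (d * e)) n₀≤n) valid
        eq₁ : ∀ b σ c d e → (b + σ * c) * (d * e) ≡ b * (d * e) + σ * e * (c * d)
        eq₁ = solve-∀
        eq₂ : ∀ σ e p k → σ * e * (p * k) ≡ p * e * (k * σ)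
        eq₂ = solve-∀

      at-invalid : ∃[ t ] ¬ Valid n t →
                   count B (boundary (suc n)) * (d * e) ≤ suc (p * e) * boundary (suc n)
      at-invalid refuted = begin
        count B (boundary (suc n)) * (d * e)    ≤⟨ *-monoˡ-≤ (d * e) (invalid-count≤ n refuted) ⟩
        boundary n * (d * e)                    ≤⟨ *-boundary≤slack d*e≤1+n ⟩
        slack n                                 ≤⟨ slack≤boundary n ⟩
        boundary (suc n)                        ≤⟨ m≤m+n (boundary (suc n)) _ ⟩
        suc (p * e) * boundary (suc n)          ∎

      at-boundary : count B (boundary (suc n)) * (d * e) ≤ suc (p * e) * boundary (suc n)
      at-boundary = [ at-valid , at-invalid ]′ (valid-or-refuted n)

    bound : ∀ m {n} → suc n₀ ≤ n → boundary n ≤ m × m < boundary (suc n) →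
            count B m * (d * e) ≤ suc (p * e) * m
    -- `block-bound` needs both ends of the block, so the preceding block must also lie past `n₀`.
    bound m {suc n} (s≤s n₀≤n) (n≤m , m<n) = block-bound (suc n) (suc (p * e)) (d * e) m
      (at-boundary n₀≤n) (at-boundary (m≤n⇒m≤1+n n₀≤n)) n≤m (<⇒≤ m<n)

  -- The bound for `B` is applied at the end of the block that guesses correctly about the given
  -- prefix. By `valid-count≥` it limits `slack n` times the count in `A`, and `slack n` cancels.
  B-bound⇒A-bound : ∀ p d e → DensityBound B p d → DensityBound A (suc (p * e)) (d * e)
  B-bound⇒A-bound p d e (N , ub) =
    suc (N ⊔ d * e) , λ { (suc k) (s≤s N≤k) → bound N≤k (valid-exists k) }
    where
    module _ {n : ℕ} (N≤n : N ⊔ d * e ≤ n) (valid : ∀ t → Valid n t) where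
      open ≤-Reasoning

      σ k b c : ℕ
      σ = slack n
      k = suc (π₁ n)
      b = count B (boundary (suc n))
      c = count A k

      d*e≤1+n : d * e ≤ suc n
      d*e≤1+n = ≤-trans (m≤n⊔m N (d * e)) (m≤n⇒m≤1+n N≤n)

      N≤boundary : N ≤ boundary (suc n)
      N≤boundary = ≤-trans (m≤m⊔n N (d * e)) (≤-trans (m≤n⇒m≤1+n N≤n) (n≤boundary (suc n)))

      at-valid : c * (d * e) ≤ suc (p * e) * k
      at-valid = *-cancelˡ-≤ σ (begin
        σ * (c * (d * e))                   ≡⟨ *-assoc σ c (d * e) ⟨
        σ * c * (d * e)                     ≤⟨ *-monoˡ-≤ (d * e) (valid-count≥ n valid) ⟩
        (boundary n + b) * (d * e)          ≡⟨ eq₁ (boundary n) b d e ⟩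
        boundary n * (d * e) + b * d * e    ≤⟨ +-mono-≤ (*-boundary≤slack d*e≤1+n)
                                                 (*-monoˡ-≤ e (ub (boundary (suc n)) N≤boundary)) ⟩
        σ + p * boundary (suc n) * e        ≤⟨ +-monoˡ-≤ _ (m≤m*n σ k) ⟩
        σ * k + p * boundary (suc n) * e    ≡⟨ eq₂ σ k p e ⟩
        σ * (suc (p * e) * k)               ∎)
        where
        eq₁ : ∀ a b d e → (a + b) * (d * e) ≡ a * (d * e) + b * d * e
        eq₁ = solve-∀
        eq₂ : ∀ σ k p e → σ * k + p * (k * σ) * e ≡ σ * (suc (p * e) * k)
        eq₂ = solve-∀

    bound : ∀ {k} → N ⊔ d * e ≤ k → ∃[ n ] k ≤ n × π₁ n ≡ k × (∀ t → Valid n t) →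
            count A (suc k) * (d * e) ≤ suc (p * e) * suc k
    bound N≤k (n , k≤n , refl , valid) = at-valid (≤-trans N≤k k≤n) valid

-- Upper densities as reals

fromℚ-≤ : ∀ {p q} → fromℚ p ≤ᴿ fromℚ q → p ℚ.≤ q
fromℚ-≤ p≤q = ℚ.≮⇒≥ λ q<p → ℚ.<-irrefl refl (p≤q q<p)

fromℚ-mono : ∀ {p q} → p ℚ.≤ q → fromℚ p ≤ᴿ fromℚ q
fromℚ-mono p≤q r<p = ℚ.<-≤-trans r<p p≤q

module _ (c m p d-1 : ℕ) .{cop : Coprime p (suc d-1)} where

  private
    c/m≃ : ℚ.toℚᵘ (ℤ.+ c ℚ./ suc m) ℚᵘ.≃ mkℚᵘ (ℤ.+ c) m
    c/m≃ = ℚ.toℚᵘ-fromℚᵘ (mkℚᵘ (ℤ.+ c) m)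

  /-≤⇒*-≤ : (ℤ.+ c ℚ./ suc m) ℚ.≤ mkℚ (ℤ.+ p) d-1 cop → c * suc d-1 ≤ p * suc m
  /-≤⇒*-≤ c/m≤q
    with ℚᵘ.*≤* le ← ℚᵘ.≤-trans (ℚᵘ.≤-reflexive (ℚᵘ.≃-sym c/m≃)) (ℚ.toℚᵘ-mono-≤ c/m≤q) =
    ℤ.drop‿+≤+ (subst₂ ℤ._≤_ (sym (ℤ.pos-* c (suc d-1))) (sym (ℤ.pos-* p (suc m))) le)

  *-≤⇒/-≤ : c * suc d-1 ≤ p * suc m → (ℤ.+ c ℚ./ suc m) ℚ.≤ mkℚ (ℤ.+ p) d-1 cop
  *-≤⇒/-≤ le = ℚ.toℚᵘ-cancel-≤ (ℚᵘ.≤-trans (ℚᵘ.≤-reflexive c/m≃)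
    (ℚᵘ.*≤* (subst₂ ℤ._≤_ (ℤ.pos-* c (suc d-1)) (ℤ.pos-* p (suc m)) (ℤ.+≤+ le))))

≤ᴿ-fromℚ : ∀ {x q} → U x q → x ≤ᴿ fromℚ q
≤ᴿ-fromℚ {x} {q} Uq {p} Lp = ℚ.≰⇒> λ q≤p → disjoint x (Lp , U-closed′ q≤p)
  where
  U-closed′ : ∀ {p} → q ℚ.≤ p → U x p
  U-closed′ {p} q≤p with U-open x Uq
  ... | m , m<q , Um = U-closed x (ℚ.<-≤-trans m<q q≤p) Um

Sequence : Set₁
Sequence = (m : ℕ) .{{_ : NonZero m}} → ℝ

eventually-≤ : ∀ (a : Sequence) u v → EventualUpperBound a u → u ≤ᴿ v → EventualUpperBound a v
eventually-≤ _ u v (N , ub) u≤v = N , λ m N≤m Lq → u≤v (ub m N≤m Lq)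

-- The strict loss `q < q′` leaves room for the error terms and, being arbitrarily small, does not
-- affect limits superior.
Transfers : Sequence → Sequence → Set
Transfers a b = ∀ {q q′} → q ℚ.< q′ →
                EventualUpperBound a (fromℚ q) → EventualUpperBound b (fromℚ q′)

limsup-transfers : ∀ (a b : Sequence) r → Transfers a b → Transfers b a →
                   IsLimsup a r → IsLimsup b r
limsup-transfers a b r a→b b→a (lower , greatest) = lower′ , greatest′
  where
  lower′ : ∀ u → EventualUpperBound b u → r ≤ᴿ u
  -- If `u < q₁`, then `q₁` eventually bounds `b`, so `q₂` eventually bounds `a`, and `r ≤ q₂`
  -- contradicts `L r q₂`.
  lower′ u bound {q} Lq
    with q₁ , q<q₁ , L₁ ← L-open r Lq
    with q₂ , q₁<q₂ , L₂ ← L-open r L₁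
    with located u q<q₁
  ... | inj₁ Lu = Lu
  ... | inj₂ Uu = contradiction
    (lower (fromℚ q₂) (b→a q₁<q₂ (eventually-≤ b u (fromℚ q₁) bound (≤ᴿ-fromℚ {u} Uu))) L₂)
    (ℚ.<-irrefl refl)

  -- r is only a greatest lower bound, so an eventual upper bound of a close to r
  -- cannot be exhibited; but r < q₁ is to be refuted, and for that it is enough
  -- that q₂ > q₁ cannot fail to be one.
  greatest′ : ∀ l → (∀ u → EventualUpperBound b u → l ≤ᴿ u) → l ≤ᴿ r
  greatest′ l l≤ {q} Lq
    with q₃ , q<q₃ , L₃ ← L-open l Lq
    with q₂ , q<q₂ , q₂<q₃ ← ℚ.<-dense q<q₃
    with q₁ , q<q₁ , q₁<q₂ ← ℚ.<-dense q<q₂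
    with located r q<q₁
  ... | inj₁ Lr = Lr
  ... | inj₂ Ur = ⊥-elim (disjoint r (greatest (fromℚ q₂) below q₁<q₂ , Ur))
    where
    -- Otherwise `q₃` would eventually bound `b`, although `q₃ < l`.
    unbounded : ¬ EventualUpperBound a (fromℚ q₂)
    unbounded bound = ℚ.<-irrefl refl (l≤ (fromℚ q₃) (a→b q₂<q₃ bound) L₃)

    below : ∀ u → EventualUpperBound a u → fromℚ q₂ ≤ᴿ u
    below u bound q<q₂ with located u q<q₂
    ... | inj₁ Lu = Lu
    ... | inj₂ Uu = contradiction (eventually-≤ a u (fromℚ q₂) bound (≤ᴿ-fromℚ {u} Uu)) unbounded

densities : SetOfℕ → Sequence
densities X m = fromℚ (ρ X m)

ρ-nonneg : ∀ X m .{{_ : NonZero m}} → ℚ.0ℚ ℚ.≤ ρ X m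
ρ-nonneg X (suc m) = ℚ.toℚᵘ-cancel-≤ (ℚᵘ.≤-trans (ℚᵘ.nonNegative⁻¹ _ )
    (ℚᵘ.≤-reflexive (ℚᵘ.≃-sym (ℚ.toℚᵘ-fromℚᵘ (mkℚᵘ (ℤ.+ count X (suc m)) m)))))

negative-≱0 : ∀ {n d-1} .{cop : Coprime (suc n) (suc d-1)} → ¬ ℚ.0ℚ ℚ.≤ mkℚ -[1+ n ] d-1 cop
negative-≱0 (ℚ.*≤* ())

-- Densities are nonnegative, which excludes negative bounds. Otherwise the precision `e` is the
-- denominator of `q′`, as `density-weaken` requires.
density-transfers : ∀ X Y →
  (∀ p d e → DensityBound X p d → DensityBound Y (suc (p * e)) (d * e)) →
  Transfers (densities X) (densities Y)
density-transfers X _ tr {mkℚ -[1+ _ ] _ _} _ (N , ub) = ⊥-elim (negative-≱0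
  (ℚ.≤-trans {_} {ρ X (suc N)} (ρ-nonneg X (suc N)) (fromℚ-≤ {ρ X (suc N)} (ub (suc N) (n≤1+n N)))))
density-transfers _ _ tr {mkℚ (ℤ.+ _) _ _} {mkℚ -[1+ _ ] _ _} q<q′ _ =
  ⊥-elim (negative-≱0 (ℚ.≤-trans (ℚ.nonNegative⁻¹ _) (ℚ.<⇒≤ q<q′)))
density-transfers X Y tr {mkℚ (ℤ.+ p) d-1 _} {mkℚ (ℤ.+ p′) d′-1 _} (ℚ.*<* lt) (N , ub) =
  proj₁ Y-bound , λ { (suc m) N≤m →
    fromℚ-mono {ρ Y (suc m)} (*-≤⇒/-≤ (count Y (suc m)) m p′ d′-1 (proj₂ Y-bound (suc m) N≤m)) }
  where
  X-bound : DensityBound X p (suc d-1)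
  -- The threshold `suc N` excludes `m = 0`, where `ρ` is not defined.
  X-bound = suc N , λ { (suc m) N<m →
    /-≤⇒*-≤ (count X (suc m)) m p d-1 (fromℚ-≤ {ρ X (suc m)} (ub (suc m) (<⇒≤ N<m))) }

  Y-bound : DensityBound Y p′ (suc d′-1)
  Y-bound = density-weaken {X = Y} {p} {suc d-1} {p′} {suc d′-1}
    (ℤ.drop‿+<+ (subst₂ ℤ._<_ (sym (ℤ.pos-* p (suc d′-1))) (sym (ℤ.pos-* p′ (suc d-1))) lt))
    (tr p (suc d-1) (suc d′-1) X-bound)

nCE⇒coCE : ∀ {A n} r → IsNCE n A → IsUpperDensity A r → ∃[ B ] IsCoCE B × IsUpperDensity B r
nCE⇒coCE {A} r nce A-density = B , B-coCE ,
  limsup-transfers (densities A) (densities B) r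
    (density-transfers A B A-bound⇒B-bound) (density-transfers B A B-bound⇒A-bound) A-density
  where
  open IsNCE nce
  open Construction computable initial limit

corollary6p2 : (r : ℝ) → 0ᴿ ≤ᴿ r → r ≤ᴿ 1ᴿ → (n : ℕ) → 2 ≤ n →
    (∃[ A ] IsNCE n A × IsUpperDensity A r) ⇔ (∃[ B ] IsCoCE B × IsUpperDensity B r)
corollary6p2 r _ _ n 2≤n = mk⇔
  (λ (A , nce , density) → nCE⇒coCE r nce density)
  (λ (B , coce , density) → B , coCE⇒nCE 2≤n coce , density)
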